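{- (Soundness.) If $\Gamma\vdash t:A$ is derivable in $\lambda_{\mathrm{MLL}}$, then $\vdash \Gamma^{\perp},A$ is derivable in MLL, where $\Gamma^\perp$ is the multiset of the linear negations of the formulae assigned by $\Gamma$. (Completeness.) If $\vdash\Gamma_0$ is derivable in MLL and $\Gamma,A$ is any permutation of $\Gamma_0$ (with $\Gamma=A_1,\dots,A_n$), then there exists a term $t$ such that $a_1:A_1^\perp,\dots,a_n:A_n^\perp\vdash t:A$ is derivable in $\lambda_{\mathrm{MLL}}$, where $a_1,\dots,a_n$ are distinct linear variables.
   Context: MLL formulae: $A,B::=\alpha\mid\overline{\alpha}\mid A\otimes B\mid A\multimap B$, where $\alpha$ ranges over a denumerable set of atomic formulae, each with a negative version $\overline\alpha$. Linear negation is the involution $\alpha^\perp=\overline\alpha$, $\overline\alpha^\perp=\alpha$, $(A\otimes B)^\perp=A\multimap B^\perp$, $(A\multimap B)^\perp=A\otimes B^\perp$. MLL sequents $\vdash\Gamma$, with $\Gamma$ a finite multiset of MLL formulae, are derived by the rules (premises $\Rightarrow$ conclusion): (ax) $\Rightarrow\ \vdash A,A^\perp$; (cut) $\vdash\Gamma,A$ and $\vdash\Gamma',A^\perp$ $\Rightarrow$ $\vdash\Gamma,\Gamma'$; ($\otimes$) $\vdash\Gamma,A$ and $\vdash\Gamma',B$ $\Rightarrow$ $\vdash\Gamma,\Gamma',A\otimes B$; ($\multimap$) $\vdash\Gamma,A^\perp,B$ $\Rightarrow$ $\vdash\Gamma,A\multimap B$. Terms of $\lambda_{\mathrm{MLL}}$: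 $t,s::=a\mid\langle t,s\rangle\mid s[\langle a,b\rangle:=t]\mid\lambda a.t\mid t\bullet s\mid t\blacktriangledown s$, where $a,b,\dots$ are linear variables; $s[\langle a,b\rangle:=t]$ binds $a,b$ in $s$ and $\lambda a.t$ binds $a$ in $t$; terms are taken up to $\alpha$-renaming. Typing judgements are $\Gamma\vdash t:A$ with $\Gamma$ a partial function of finite domain from variables to MLL formulae; $\Gamma,\Gamma'$ denotes union of environments with disjoint domains. Typing rules: (ax) $\Rightarrow\ a:A\vdash a:A$; (i$\otimes$) $\Gamma\vdash t:A$ and $\Gamma'\vdash s:B$ $\Rightarrow$ $\Gamma,\Gamma'\vdash\langle t,s\rangle:A\otimes B$; (e$\otimes$) $\Gamma\vdash t:A\otimes B$ and $\Gamma',a:A,b:B\vdash s:C$ $\Rightarrow$ $\Gamma,\Gamma'\vdash s[\langle a,b\rangle:=t]:C$; (i$\multimap$) $\Gamma,a:A\vdash t:B$ $\Rightarrow$ $\Gamma\vdash\lambda a.t:A\multimap B$; (e$\multimap_1$) $\Gamma\vdash t:A\multimap B$ and $\Gamma'\vdash s:A$ $\Rightarrow$ $\Gamma,\Gamma'\vdash t\bullet s:B$; (e$\multimap_2$) $\Gamma\vdash t:A\multimap B$ and $\Gamma'\vdash s:B^\perp$ $\Rightarrow$ $\Gamma,\Gamma'\vdash t\blacktriangledown s:A^\perp$. -}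

module Defs where

open import Data.Fin.Base using (Fin; fromℕ; inject₁)
open import Data.List.Base using (List; []; _∷_; [_]; _++_; map)
open import Data.List.Properties using (map-++)
open import Data.List.Relation.Binary.Disjoint.Propositional using (Disjoint)
open import Data.List.Relation.Binary.Permutation.Propositional using (_↭_; ↭⇒↭ₛ)
open import Data.List.Relation.Binary.Permutation.Propositional.Properties using (map⁺; ++-comm)
import Data.List.Relation.Binary.Permutation.Setoid.Properties as Permutation
open import Data.List.Relation.Unary.All using ([])
open import Data.List.Relation.Unary.AllPairs using ([]; _∷_)
open import Data.List.Relation.Unary.Unique.Propositional using (Unique)
open import Data.List.Relation.Unary.Unique.Propositional.Properties using (++⁺)
open import Data.Nat.Base using (ℕ; suc)
open import Data.Nat.Properties using (_≟_)
open import Data.Product.Base using (_×_; _,_; proj₁; proj₂)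
open import Relation.Binary.PropositionalEquality using (_≡_; refl; cong; subst; sym; setoid)
open import Relation.Nullary.Decidable.Core using (yes; no)

infix  20 _⊥
infixr 7  _⊗_ _⊸_
infix  3  ⊢_ _⊢_∶_

------------------------------------------------------------------------
-- Formulae

data Formula : Set where
  atom     : ℕ → Formula
  neg-atom : ℕ → Formula
  _⊗_ _⊸_  : Formula → Formula → Formula

_⊥ : Formula → Formula
(atom α) ⊥     = neg-atom α
(neg-atom α) ⊥ = atom α
(A ⊗ B) ⊥      = A ⊸ B ⊥
(A ⊸ B) ⊥      = A ⊗ B ⊥

⊥-involutive : ∀ A → A ⊥ ⊥ ≡ A
⊥-involutive (atom α)     = refl
⊥-involutive (neg-atom α) = refl
⊥-involutive (A ⊗ B)      = cong (A ⊗_) (⊥-involutive B)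
⊥-involutive (A ⊸ B)      = cong (A ⊸_) (⊥-involutive B)

------------------------------------------------------------------------
-- Sequent calculus

-- Multisets are lists up to permutation; the rule exch makes
-- derivability a property of the multiset.
data ⊢_ : List Formula → Set where
  ax   : ∀ {A} → ⊢ A ∷ A ⊥ ∷ []
  cut  : ∀ {Γ Γ′ A} → ⊢ Γ ++ [ A ] → ⊢ Γ′ ++ [ A ⊥ ] → ⊢ Γ ++ Γ′
  ⊗-r  : ∀ {Γ Γ′ A B} → ⊢ Γ ++ [ A ] → ⊢ Γ′ ++ [ B ] → ⊢ Γ ++ Γ′ ++ [ A ⊗ B ]
  ⊸-r  : ∀ {Γ A B} → ⊢ Γ ++ A ⊥ ∷ B ∷ [] → ⊢ Γ ++ [ A ⊸ B ]
  exch : ∀ {Γ Δ} → Γ ↭ Δ → ⊢ Γ → ⊢ Δ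

------------------------------------------------------------------------
-- Terms

Var : Set
Var = ℕ

-- Locally nameless syntax: free variables are names and bound variables
-- are de Bruijn indices, so that α-equivalent terms are equal.
-- PreTerm n has n outer binders pending; terms proper have none.
data PreTerm (n : ℕ) : Set where
  free  : Var → PreTerm n
  bound : Fin n → PreTerm n
  ⟨_,_⟩ : PreTerm n → PreTerm n → PreTerm n
  letp  : PreTerm (suc (suc n)) → PreTerm n → PreTerm n
  lam   : PreTerm (suc n) → PreTerm n
  _•_   : PreTerm n → PreTerm n → PreTerm n
  _▼_   : PreTerm n → PreTerm n → PreTerm n

Term : Set
Term = PreTerm 0

-- Turns the free variable a into a new outermost binder, which is the one
-- with the largest index.
bind : ∀ {n} → Var → PreTerm n → PreTerm (suc n)
bind {n} a (free b) with a ≟ b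
... | yes _ = bound (fromℕ n)
... | no  _ = free b
bind a (bound i)  = bound (inject₁ i)
bind a ⟨ t , s ⟩  = ⟨ bind a t , bind a s ⟩
bind a (letp s t) = letp (bind a s) (bind a t)
bind a (lam t)    = lam (bind a t)
bind a (t • s)    = bind a t • bind a s
bind a (t ▼ s)    = bind a t ▼ bind a s

-- The term λa.t.
ƛ : Var → Term → Term
ƛ a t = lam (bind a t)

-- The term s[⟨a,b⟩:=t].
_[⟨_,_⟩:=_] : Term → Var → Var → Term → Term
s [⟨ a , b ⟩:= t ] = letp (bind a (bind b s)) t

------------------------------------------------------------------------
-- Typing

-- An environment is a finite list of bindings up to permutation; those of
-- derivable judgements bind each variable at most once (see functional).
Env : Set
Env = List (Var × Formula)

dom : Env → List Var
dom = map proj₁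

_⊥ᴱ : Env → List Formula
Γ ⊥ᴱ = map (λ b → proj₂ b ⊥) Γ

data _⊢_∶_ : Env → Term → Formula → Set where
  ax   : ∀ {a A} → [ a , A ] ⊢ free a ∶ A
  i⊗   : ∀ {Γ Γ′ t s A B} → Disjoint (dom Γ) (dom Γ′) →
         Γ ⊢ t ∶ A → Γ′ ⊢ s ∶ B → Γ ++ Γ′ ⊢ ⟨ t , s ⟩ ∶ A ⊗ B
  e⊗   : ∀ {Γ Γ′ t s a b A B C} → Disjoint (dom Γ) (dom Γ′) →
         Γ ⊢ t ∶ A ⊗ B → Γ′ ++ (a , A) ∷ (b , B) ∷ [] ⊢ s ∶ C →
         Γ ++ Γ′ ⊢ s [⟨ a , b ⟩:= t ] ∶ C
  i⊸   : ∀ {Γ t a A B} → Γ ++ [ a , A ] ⊢ t ∶ B → Γ ⊢ ƛ a t ∶ A ⊸ B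
  e⊸₁  : ∀ {Γ Γ′ t s A B} → Disjoint (dom Γ) (dom Γ′) →
         Γ ⊢ t ∶ A ⊸ B → Γ′ ⊢ s ∶ A → Γ ++ Γ′ ⊢ t • s ∶ B
  e⊸₂  : ∀ {Γ Γ′ t s A B} → Disjoint (dom Γ) (dom Γ′) →
         Γ ⊢ t ∶ A ⊸ B → Γ′ ⊢ s ∶ B ⊥ → Γ ++ Γ′ ⊢ t ▼ s ∶ A ⊥
  exch : ∀ {Γ Δ t A} → Γ ↭ Δ → Γ ⊢ t ∶ A → Δ ⊢ t ∶ A

private
  unique-resp-↭ : {xs ys : List Var} → xs ↭ ys → Unique xs → Unique ys
  unique-resp-↭ p = Permutation.Unique-resp-↭ (setoid Var) (↭⇒↭ₛ p)

  unique-++ʳ : (xs {ys} : List Var) → Unique (xs ++ ys) → Unique ys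
  unique-++ʳ []       u       = u
  unique-++ʳ (_ ∷ xs) (_ ∷ u) = unique-++ʳ xs u

  dom-weaken : ∀ Γ Δ → Unique (dom (Γ ++ Δ)) → Unique (dom Γ)
  dom-weaken Γ Δ u = unique-++ʳ (dom Δ)
    (unique-resp-↭ (++-comm (dom Γ) (dom Δ)) (subst Unique (map-++ proj₁ Γ Δ) u))

  dom-union : ∀ Γ Δ → Disjoint (dom Γ) (dom Δ) →
              Unique (dom Γ) → Unique (dom Δ) → Unique (dom (Γ ++ Δ))
  dom-union Γ Δ d u v = subst Unique (sym (map-++ proj₁ Γ Δ)) (++⁺ u v d)

functional : ∀ {Γ t A} → Γ ⊢ t ∶ A → Unique (dom Γ)
functional ax = [] ∷ []
functional (i⊗ {Γ} {Γ′} d p q) = dom-union Γ Γ′ d (functional p) (functional q)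
functional (e⊗ {Γ} {Γ′} d p q) =
  dom-union Γ Γ′ d (functional p) (dom-weaken Γ′ _ (functional q))
functional (i⊸ {Γ} p) = dom-weaken Γ _ (functional p)
functional (e⊸₁ {Γ} {Γ′} d p q) = dom-union Γ Γ′ d (functional p) (functional q)
functional (e⊸₂ {Γ} {Γ′} d p q) = dom-union Γ Γ′ d (functional p) (functional q)
functional (exch p q) = unique-resp-↭ (map⁺ proj₁ p) (functional q)

{-# OPTIONS --safe #-}

-- For completeness, any formula of a derivable sequent may serve as the type
-- of the term: from b : B ⊥ ⊢ t : A one obtains (λb.t) ▼ a : B in a context
-- with a : A ⊥. Hence each rule need only be interpreted with one convenient
-- formula in focus, and a cut becomes the application of an abstraction, so no
-- substitution lemma is required.
module Submission where

open import Defs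
open import Data.List.Base using (List; []; _∷_; [_]; _++_; map; zip; length)
open import Data.List.Extrema.Nat using (max; xs≤max)
open import Data.List.Membership.Propositional using (_∈_)
open import Data.List.Membership.Propositional.Properties using (∈-++⁻; ∈-∃++)
open import Data.List.Properties using (map-++; ++-assoc; ∷-injective)
open import Data.List.Relation.Binary.Disjoint.Propositional using (Disjoint)
open import Data.List.Relation.Binary.Permutation.Propositional
  using (_↭_; prep; swap; ↭-refl; ↭-reflexive; ↭-sym; ↭-trans; ↭⇒↭ₛ)
open import Data.List.Relation.Binary.Permutation.Propositional.Properties
  using (map⁺; ↭-map-inv; ∈-resp-↭; drop-∷; shift; ++-comm; ++⁺ˡ; ++⁺ʳ; ∷↭∷ʳ)
import Data.List.Relation.Binary.Permutation.Setoid.Properties as Permutation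
open import Data.List.Relation.Unary.All as All using (All; []; _∷_)
import Data.List.Relation.Unary.All.Properties as All
open import Data.List.Relation.Unary.AllPairs as AllPairs using ([]; _∷_)
open import Data.List.Relation.Unary.Any using (here; there)
open import Data.List.Relation.Unary.Unique.Propositional using (Unique)
open import Data.Nat.Base using (suc; s≤s)
open import Data.Nat.Properties using (>⇒≢; suc-injective)
open import Data.Product.Base using (_×_; _,_; proj₁; ∃-syntax)
open import Data.Sum.Base using (inj₁; inj₂)
open import Function.Base using (_∘_)
open import Relation.Binary.PropositionalEquality
  using (_≡_; _≢_; refl; sym; cong; cong₂; subst; setoid)

private
  variable
    Γ Γ′ Δ : List Formula
    A B C  : Formula

ax′ : ⊢ A ⊥ ∷ A ∷ []
ax′ = exch (swap _ _ ↭-refl) ax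

-- Since `(A ⊗ B) ⊥` is `A ⊸ B ⊥`, the hypotheses `A ⊥` and `B ⊥` are joined by `⊸-r` into a formula
-- that cuts against `A ⊗ B`.
⊗-elim : ∀ Γ Γ′ → ⊢ Γ ++ [ A ⊗ B ] → ⊢ (Γ′ ++ A ⊥ ∷ B ⊥ ∷ []) ++ [ C ] →
         ⊢ (Γ ++ Γ′) ++ [ C ]
⊗-elim {A} {B} {C} Γ Γ′ d e =
  exch (↭-reflexive (sym (++-assoc Γ Γ′ [ C ])))
    (cut {Γ} {Γ′ ++ [ C ]} d (⊸-r {Γ′ ++ [ C ]} (exch C-inwards e)))
  where
  C-inwards : (Γ′ ++ A ⊥ ∷ B ⊥ ∷ []) ++ [ C ] ↭ (Γ′ ++ [ C ]) ++ A ⊥ ∷ B ⊥ ∷ []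
  C-inwards =
    ↭-trans (↭-reflexive (++-assoc Γ′ _ _))
      (↭-trans (++⁺ˡ Γ′ (++-comm (A ⊥ ∷ B ⊥ ∷ []) [ C ]))
        (↭-reflexive (sym (++-assoc Γ′ _ _))))

-- A cut against `(A ⊸ B) ⊥`, that is `A ⊗ B ⊥`, whose factor `B ⊥` comes from an axiom that leaves
-- `B` behind.
⊸-elim₁ : ∀ Γ Γ′ → ⊢ Γ ++ [ A ⊸ B ] → ⊢ Γ′ ++ [ A ] → ⊢ (Γ ++ Γ′) ++ [ B ]
⊸-elim₁ {B = B} Γ Γ′ d e =
  exch (↭-reflexive (sym (++-assoc Γ Γ′ [ B ])))
    (cut {Γ} {Γ′ ++ [ B ]} d
      (exch (↭-reflexive (sym (++-assoc Γ′ [ B ] _))) (⊗-r {Γ′} {[ B ]} e ax)))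

-- The same cut formula, but now the axiom supplies the factor `A` and leaves `A ⊥`.
⊸-elim₂ : ∀ Γ Γ′ → ⊢ Γ ++ [ A ⊸ B ] → ⊢ Γ′ ++ [ B ⊥ ] → ⊢ (Γ ++ Γ′) ++ [ A ⊥ ]
⊸-elim₂ {A} Γ Γ′ d e =
  exch (↭-trans (shift (A ⊥) Γ Γ′) (∷↭∷ʳ (A ⊥) (Γ ++ Γ′)))
    (cut {Γ} {A ⊥ ∷ Γ′} d (⊗-r {[ A ⊥ ]} {Γ′} ax′ e))

union : ∀ (Γ Γ′ : Env) {Δ} → ⊢ (Γ ⊥ᴱ ++ Γ′ ⊥ᴱ) ++ Δ → ⊢ (Γ ++ Γ′) ⊥ᴱ ++ Δ
union Γ Γ′ {Δ} = subst (λ Θ → ⊢ Θ ++ Δ) (sym (map-++ _ Γ Γ′))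

split : ∀ (Γ Γ′ : Env) {Δ} → ⊢ (Γ ++ Γ′) ⊥ᴱ ++ Δ → ⊢ (Γ ⊥ᴱ ++ Γ′ ⊥ᴱ) ++ Δ
split Γ Γ′ {Δ} = subst (λ Θ → ⊢ Θ ++ Δ) (map-++ _ Γ Γ′)

soundness : ∀ {Γ t A} → Γ ⊢ t ∶ A → ⊢ Γ ⊥ᴱ ++ [ A ]
soundness ax = ax′
soundness (i⊗ {Γ} {Γ′} _ p q) =
  union Γ Γ′ (exch (↭-reflexive (sym (++-assoc (Γ ⊥ᴱ) _ _)))
    (⊗-r {Γ ⊥ᴱ} {Γ′ ⊥ᴱ} (soundness p) (soundness q)))
soundness (e⊗ {Γ} {Γ′} _ p q) =
  union Γ Γ′ (⊗-elim (Γ ⊥ᴱ) (Γ′ ⊥ᴱ) (soundness p) (split Γ′ _ (soundness q)))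
soundness (i⊸ {Γ} p) =
  ⊸-r {Γ ⊥ᴱ} (exch (↭-reflexive (++-assoc (Γ ⊥ᴱ) _ _)) (split Γ _ (soundness p)))
soundness (e⊸₁ {Γ} {Γ′} _ p q) =
  union Γ Γ′ (⊸-elim₁ (Γ ⊥ᴱ) (Γ′ ⊥ᴱ) (soundness p) (soundness q))
soundness (e⊸₂ {Γ} {Γ′} _ p q) =
  union Γ Γ′ (⊸-elim₂ (Γ ⊥ᴱ) (Γ′ ⊥ᴱ) (soundness p) (soundness q))
soundness (exch p q) = exch (++⁺ʳ _ (map⁺ _ p)) (soundness q)

Unique-resp-↭ : {as bs : List Var} → as ↭ bs → Unique as → Unique bs
Unique-resp-↭ p = Permutation.Unique-resp-↭ (setoid Var) (↭⇒↭ₛ p)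

Unique-++⁻ : ∀ (as : List Var) {bs} → Unique (as ++ bs) →
             Unique as × Unique bs × Disjoint as bs
Unique-++⁻ []       u       = [] , u , λ ()
Unique-++⁻ (a ∷ as) (h ∷ u) with v , w , d ← Unique-++⁻ as u =
  All.++⁻ˡ as h ∷ v , w , λ where
    (here refl , j) → All.lookup (All.++⁻ʳ as h) j refl
    (there i   , j) → d (i , j)

fresh : (as : List Var) → ∃[ a ] All (a ≢_) as
fresh as = suc (max 0 as) , All.map (>⇒≢ ∘ s≤s) (xs≤max 0 as)

map≡++⁻ : ∀ {X Y : Set} {f : X → Y} xs ys {zs} → map f xs ≡ ys ++ zs →
          ∃[ us ] ∃[ vs ] xs ≡ us ++ vs × map f us ≡ ys × map f vs ≡ zs
map≡++⁻ xs       []       eq   = [] , xs , refl , refl , eq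
map≡++⁻ (x ∷ xs) (y ∷ ys) eq
  with refl , eq′ ← ∷-injective eq
  with us , vs , refl , refl , eq″ ← map≡++⁻ xs ys eq′ =
  x ∷ us , vs , refl , refl , eq″

-- Quantifying over all admissible environments makes renaming of free
-- variables unnecessary.
Realisable : List Formula → Formula → Set
Realisable Γ A =
  ∀ (Δ : Env) → Unique (dom Δ) → Δ ⊥ᴱ ≡ Γ → ∃[ t ] Δ ⊢ t ∶ A

-- A permutation of the formulae lifts to the bindings, so each variable travels with its formula
-- and the term is unchanged.
realisable-resp-↭ : Γ ↭ Γ′ → Realisable Γ A → Realisable Γ′ A
realisable-resp-↭ p r Δ u refl
  with Δ′ , eq , q ← ↭-map-inv _ (↭-sym p)
  with t , d ← r Δ′ (Unique-resp-↭ (map⁺ proj₁ q) u) (sym eq) =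
  t , exch (↭-sym q) d

abstraction : ∀ {Γ t a A B} → (a , A) ∷ Γ ⊢ t ∶ B → Γ ⊢ ƛ a t ∶ A ⊸ B
abstraction d = i⊸ (exch (∷↭∷ʳ _ _) d)

realisable-ax : Realisable [ A ] (A ⊥)
realisable-ax ((a , B) ∷ []) u refl =
  free a , subst ([ a , B ] ⊢ free a ∶_) (sym (⊥-involutive B)) ax

-- The bound variable and the argument of ▼ may share the name a.
realisable-switch : Realisable (B ∷ Γ) A → Realisable (A ∷ Γ) B
realisable-switch {B} r ((a , C) ∷ Δ) u refl
  with t , d ← r ((a , B ⊥) ∷ Δ) u (cong (_∷ Δ ⊥ᴱ) (⊥-involutive B)) =
  ƛ a t ▼ free a ,
  subst (_ ⊢ _ ∶_) (⊥-involutive B)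
    (exch (↭-sym (∷↭∷ʳ _ Δ))
      (e⊸₂ disjoint (abstraction d)
        (subst ([ a , C ] ⊢ free a ∶_) (sym (⊥-involutive C)) ax)))
  where
  disjoint : Disjoint (dom Δ) [ a ]
  disjoint (i , here refl) = All.lookup (AllPairs.head u) i refl

-- Either `B` is already in focus and only the context is permuted, or it lies in `Γ`, is brought to
-- the front and trades places with `A`.
realisable-refocus : A ∷ Γ ↭ B ∷ Γ′ → Realisable Γ A → Realisable Γ′ B
realisable-refocus {A} {Γ} {B} p r with ∈-resp-↭ (↭-sym p) (here refl)
... | here refl = realisable-resp-↭ (drop-∷ p) r
... | there i with Γ₁ , Γ₂ , refl ← ∈-∃++ i =
  realisable-resp-↭
    -- Two contexts are compared by putting the focus `B` in front of both and cancelling it.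
    (drop-∷ (↭-trans (↭-trans (swap B A ↭-refl) (prep A (↭-sym (shift B Γ₁ Γ₂)))) p))
    (realisable-switch (realisable-resp-↭ (shift B Γ₁ Γ₂) r))

-- A variable outside `dom Δ` keeps the enlarged environment duplicate-free, so the hypothesis
-- applies to it.
realisable-⊸ : Realisable (A ⊥ ∷ Γ) B → Realisable Γ (A ⊸ B)
realisable-⊸ {A} r Δ u refl
  with a , a∉ ← fresh (dom Δ)
  with t , d ← r ((a , A) ∷ Δ) (a∉ ∷ u) refl = ƛ a t , abstraction d

-- The environment splits where its formulae do, and uniqueness of its names yields the disjointness
-- that `i⊗` demands.
realisable-⊗ : Realisable Γ A → Realisable Γ′ B → Realisable (Γ ++ Γ′) (A ⊗ B)
realisable-⊗ {Γ} r s Δ u eq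
  with Δ₁ , Δ₂ , refl , eq₁ , eq₂ ← map≡++⁻ Δ Γ eq
  with u₁ , u₂ , disj ← Unique-++⁻ (dom Δ₁) (subst Unique (map-++ proj₁ Δ₁ Δ₂) u)
  with _ , d ← r Δ₁ u₁ eq₁ | _ , e ← s Δ₂ u₂ eq₂ = _ , i⊗ disj d e

realisable-app : Realisable Γ (A ⊸ B) → Realisable Γ′ A → Realisable (Γ ++ Γ′) B
realisable-app {Γ} r s Δ u eq
  with Δ₁ , Δ₂ , refl , eq₁ , eq₂ ← map≡++⁻ Δ Γ eq
  with u₁ , u₂ , disj ← Unique-++⁻ (dom Δ₁) (subst Unique (map-++ proj₁ Δ₁ Δ₂) u)
  with _ , d ← r Δ₁ u₁ eq₁ | _ , e ← s Δ₂ u₂ eq₂ = _ , e⊸₁ disj d e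

realisable-cut : Realisable (C ∷ Γ) A → Realisable Γ′ (C ⊥) → Realisable (Γ ++ Γ′) A
realisable-cut {C} {Γ} {A} r =
  realisable-app {Γ} {C ⊥} (realisable-⊸
    -- The abstracted variable has type `C ⊥`, so `realisable-⊸` expects `C ⊥ ⊥` where `r` has `C`.
    (subst (λ D → Realisable (D ∷ Γ) A) (sym (⊥-involutive C)) r))

-- Serves both cases of a cut. The premise containing `A` is given in every focus, since its focus
-- must be `A`, with `C` left as a hypothesis for the other premise to fill.
realisable-cut-∈ : A ∈ Δ → (∀ {Γ A} → A ∷ Γ ↭ Δ ++ [ C ] → Realisable Γ A) →
                   Realisable Γ′ (C ⊥) → A ∷ Γ ↭ Δ ++ Γ′ → Realisable Γ A
realisable-cut-∈ {A} {C = C} {Γ′} i r s p with Δ₁ , Δ₂ , refl ← ∈-∃++ i =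
  realisable-resp-↭
    (drop-∷ (↭-trans (++⁺ʳ Γ′ (↭-sym (shift A Δ₁ Δ₂))) (↭-sym p)))
    (realisable-cut
      (r (↭-trans (swap A C ↭-refl)
        (↭-trans (prep C (↭-sym (shift A Δ₁ Δ₂))) (∷↭∷ʳ C (Δ₁ ++ A ∷ Δ₂)))))
      s)

-- Induction on the derivation for all foci at once: each premise can be read in the focus its rule
-- needs, and `exch` merely composes permutations.
completeness : ⊢ Δ → A ∷ Γ ↭ Δ → Realisable Γ A
completeness (ax {B}) p =
  realisable-refocus (↭-trans (swap (B ⊥) B ↭-refl) (↭-sym p)) realisable-ax
completeness (cut {Γ₁} {Γ₂} {C} d e) p
  with ∈-++⁻ Γ₁ (∈-resp-↭ p (here refl))
... | inj₁ i = realisable-cut-∈ i (completeness d) (completeness e (∷↭∷ʳ (C ⊥) Γ₂)) p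
-- The premises swap roles: the cut formula is now `C ⊥`, so the first premise must supply `C ⊥ ⊥`.
... | inj₂ i = realisable-cut-∈ i (completeness e)
  (subst (Realisable Γ₁) (sym (⊥-involutive C)) (completeness d (∷↭∷ʳ C Γ₁)))
  (↭-trans p (++-comm Γ₁ Γ₂))
completeness (⊗-r {Γ₁} {Γ₂} {B} {C} d e) p =
  realisable-refocus
    (↭-trans (↭-trans (∷↭∷ʳ (B ⊗ C) (Γ₁ ++ Γ₂)) (↭-reflexive (++-assoc Γ₁ Γ₂ _)))
      (↭-sym p))
    (realisable-⊗ (completeness d (∷↭∷ʳ B Γ₁)) (completeness e (∷↭∷ʳ C Γ₂)))
completeness (⊸-r {Γ₁} {B} {C} d) p =
  realisable-refocus (↭-trans (∷↭∷ʳ (B ⊸ C) Γ₁) (↭-sym p))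
    (realisable-⊸
      (completeness d
        (↭-trans (swap C (B ⊥) ↭-refl) (++-comm (B ⊥ ∷ C ∷ []) Γ₁))))
completeness (exch q d) p = completeness d (↭-trans p (↭-sym q))

dom-zip : ∀ (as : List Var) (Γ : List Formula) → length as ≡ length Γ →
          dom (zip as (map _⊥ Γ)) ≡ as
dom-zip []       []      _  = refl
dom-zip (a ∷ as) (A ∷ Γ) eq = cong (a ∷_) (dom-zip as Γ (suc-injective eq))

zip-⊥ᴱ : ∀ (as : List Var) (Γ : List Formula) → length as ≡ length Γ →
         zip as (map _⊥ Γ) ⊥ᴱ ≡ Γ
zip-⊥ᴱ []       []      _  = refl
zip-⊥ᴱ (a ∷ as) (A ∷ Γ) eq =
  cong₂ _∷_ (⊥-involutive A) (zip-⊥ᴱ as Γ (suc-injective eq))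

lemma4 : (∀ (Γ : Env) (t : Term) (A : Formula) →
    Γ ⊢ t ∶ A → ⊢ (Γ ⊥ᴱ ++ [ A ]))
    ×
    (∀ (Γ₀ Γ : List Formula) (A : Formula) →
    ⊢ Γ₀ → (Γ ++ [ A ]) ↭ Γ₀ →
    ∀ (as : List Var) → length as ≡ length Γ → Unique as →
    ∃[ t ] (zip as (map _⊥ Γ) ⊢ t ∶ A))
lemma4 =
  (λ _ _ _ → soundness) ,
  λ Γ₀ Γ A d p as len u →
    -- The prescribed environment is admissible for `Realisable`: its names are `as`, and negating
    -- its types gives back `Γ`.
    completeness d (↭-trans (∷↭∷ʳ A Γ) p) (zip as (map _⊥ Γ))
      (subst Unique (sym (dom-zip as Γ len)) u) (zip-⊥ᴱ as Γ len)
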